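{- Let $G$ be a matrix weighted connected graph of order $n$ and let $L=L(G)$. Then $$Kf(G)=n\sum_{i\in V(G)}L_{ii}^+,$$ where $L_{ii}^+$ denotes the $i$-th diagonal block of the Moore-Penrose inverse $L^+$ of $L$.
   Context: A matrix weighted graph is a finite, simple, undirected, connected graph in which each edge $ij$ is assigned a weight $W_{ij}=W_{ji}$ that is a (real symmetric) positive definite matrix of a given order $k$. For a matrix weighted graph $G$ with vertices $1,\dots,n$, the Laplacian $L=L(G)$ is the $nk\times nk$ block matrix with $k\times k$ blocks $L_{ii}=\sum_{j\sim i}W_{ij}^{ -1}$, $L_{ij}=-W_{ij}^{ -1}$ if $i\neq j$ and $i\sim j$, and $L_{ij}=0$ if $i\ne j$ and $i\nsim j$. A $(1)$-inverse of a matrix $M$ is a matrix $C$ with $MCM=M$. The resistance matrix $R(G)$ is the $nk\times nk$ block matrix with blocks $R_{ij}=L^{(1)}_{ii}+L^{(1)}_{jj}-L^{(1)}_{ij}-L^{(1)}_{ji}$, where $L^{(1)}$ is any $(1)$-inverse of $L$ (the result does not depend on the choice; $L^+$ is one choice). The Kirchhoff index of a connected matrix weighted graph is the $k\times k$ matrix $Kf(G)=\frac12\sum_{i\in V(G)}\sum_{j\in V(G)}R_{ij}$. -}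

module Defs where

open import Level using (Level; 0ℓ; _⊔_) renaming (suc to lsuc)
open import Algebra.Apartness.Bundles using (HeytingField; HeytingCommutativeRing)
open import Algebra.Bundles using (CommutativeRing)
import Algebra.Definitions.RawMonoid as RawMonoidDefs
import Algebra.Properties.Semiring.Sum as SemiringSum
open import Data.Fin.Base using (Fin; combine; remQuot)
import Data.Fin.Properties as Fin
open import Data.Nat.Base as ℕ using (ℕ)
open import Data.Product.Base using (∃-syntax; _×_; _,_; proj₁)
open import Data.Sum.Base using (_⊎_)
open import Data.Vec.Functional using (Vector)
open import Relation.Binary.Core using (Rel)
open import Relation.Binary.Construct.Closure.ReflexiveTransitive using (Star)
open import Relation.Binary.Definitions using (Decidable; Symmetric)
open import Relation.Binary.Structures using (IsStrictPartialOrder)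
open import Relation.Nullary.Decidable.Core using (yes; no)
open import Relation.Nullary.Negation.Core using (¬_)

private
  variable
    c ℓ₁ ℓ₂ : Level

-- There is no type of real numbers in the library, so ℝ is given by its
-- axioms, as a Cauchy-complete Archimedean ordered field. Two reals are
-- apart exactly when one is strictly below the other; no decidability of
-- equality or order is assumed, so that constructions of ℝ by Cauchy
-- sequences or by Dedekind cuts are models. Classically, with `_#_` the
-- negation of `_≈_`, this is the usual axiomatic description of ℝ.
record RealNumbers c ℓ₁ ℓ₂ : Set (lsuc (c ⊔ ℓ₁ ⊔ ℓ₂)) where
  infix 4 _<_

  field
    heytingField : HeytingField c ℓ₁ ℓ₂

  open HeytingField heytingField public

  commutativeRing : CommutativeRing c ℓ₁
  commutativeRing = HeytingCommutativeRing.commutativeRing heytingCommutativeRing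

  open CommutativeRing commutativeRing public using (semiring; +-rawMonoid)
  open RawMonoidDefs +-rawMonoid public using () renaming (_×_ to _·_)

  field
    _<_                  : Rel Carrier ℓ₂
    isStrictPartialOrder : IsStrictPartialOrder _≈_ _<_
    <⇒#                  : ∀ {x y} → x < y → x # y
    #⇒<⊎>                : ∀ {x y} → x # y → x < y ⊎ y < x
    0<1                  : 0# < 1#
    +-monoˡ-<            : ∀ z {x y} → x < y → x + z < y + z
    *-pos                : ∀ {x y} → 0# < x → 0# < y → 0# < x * y

  open IsStrictPartialOrder isStrictPartialOrder public
    using (<-resp-≈; <-respˡ-≈)
    renaming (irrefl to <-irrefl; trans to <-trans)

  IsCauchy : (ℕ → Carrier) → Set (c ⊔ ℓ₂)
  IsCauchy s = ∀ ε → 0# < ε →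
    ∃[ N ] (∀ m n → N ℕ.≤ m → N ℕ.≤ n → s m - s n < ε)

  _ConvergesTo_ : (ℕ → Carrier) → Carrier → Set (c ⊔ ℓ₂)
  s ConvergesTo l = ∀ ε → 0# < ε →
    ∃[ N ] (∀ n → N ℕ.≤ n → (s n - l < ε) × (l - s n < ε))

  field
    archimedean : ∀ x → ∃[ n ] (x < n · 1#)
    complete    : ∀ s → IsCauchy s → ∃[ l ] (s ConvergesTo l)

  0<2 : 0# < 1# + 1#
  0<2 = <-trans 0<1 (<-respˡ-≈ (+-identityˡ 1#) (+-monoˡ-< 1# 0<1))

  ½ : Carrier
  ½ = proj₁ (#⇒invertible (#-sym (<⇒# 0<2)))

module MatrixWeighted (ℝ : RealNumbers c ℓ₁ ℓ₂) where

  open RealNumbers ℝ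
  open SemiringSum semiring using (sum-syntax)

  Matrix : ℕ → ℕ → Set c
  Matrix m n = Vector (Vector Carrier n) m

  infix  4 _≈ᴹ_
  infixl 7 _*ᴹ_
  infix  9 _ᵀ

  _≈ᴹ_ : ∀ {m n} → Rel (Matrix m n) ℓ₁
  A ≈ᴹ B = ∀ a b → A a b ≈ B a b

  Iᴹ : ∀ {m} → Matrix m m
  Iᴹ a b with a Fin.≟ b
  ... | yes _ = 1#
  ... | no  _ = 0#

  _ᵀ : ∀ {m n} → Matrix m n → Matrix n m
  (A ᵀ) a b = A b a

  _*ᴹ_ : ∀ {l m n} → Matrix l m → Matrix m n → Matrix l n
  _*ᴹ_ {m = m} A B a b = ∑[ d < m ] (A a d * B d b)

  sumᴹ : ∀ {l m n} → (Fin l → Matrix m n) → Matrix m n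
  sumᴹ {l} A a b = ∑[ i < l ] A i a b

  IsSymmetric : ∀ {m} → Matrix m m → Set ℓ₁
  IsSymmetric A = A ᵀ ≈ᴹ A

  quadraticForm : ∀ {m} → Matrix m m → Vector Carrier m → Carrier
  quadraticForm {m} A x = ∑[ a < m ] ∑[ b < m ] (x a * A a b * x b)

  -- A nonzero vector is one having an entry apart from 0.
  NonZeroVector : ∀ {m} → Vector Carrier m → Set ℓ₂
  NonZeroVector x = ∃[ a ] (x a # 0#)

  record IsPositiveDefinite {m} (A : Matrix m m) : Set (c ⊔ ℓ₁ ⊔ ℓ₂) where
    field
      symmetric : IsSymmetric A
      positive  : ∀ x → NonZeroVector x → 0# < quadraticForm A x

  record IsInverse {m} (A A⁻¹ : Matrix m m) : Set ℓ₁ where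
    field
      inverseˡ : A⁻¹ *ᴹ A ≈ᴹ Iᴹ
      inverseʳ : A *ᴹ A⁻¹ ≈ᴹ Iᴹ

  Is[1]-Inverse : ∀ {m} → Matrix m m → Matrix m m → Set ℓ₁
  Is[1]-Inverse M C = M *ᴹ C *ᴹ M ≈ᴹ M

  record IsMoorePenroseInverse {m} (M M⁺ : Matrix m m) : Set ℓ₁ where
    field
      MM⁺M≈M        : M *ᴹ M⁺ *ᴹ M ≈ᴹ M
      M⁺MM⁺≈M⁺      : M⁺ *ᴹ M *ᴹ M⁺ ≈ᴹ M⁺
      MM⁺-symmetric : IsSymmetric (M *ᴹ M⁺)
      M⁺M-symmetric : IsSymmetric (M⁺ *ᴹ M)

  -- An nk × nk matrix is seen as an n × n array of k × k blocks: row i·k + a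
  -- (that is, `combine i a`) is row a of block row i, likewise for columns.
  block : ∀ {n k} → Matrix (n ℕ.* k) (n ℕ.* k) → Fin n → Fin n → Matrix k k
  block M i j a b = M (combine i a) (combine j b)

  fromBlocks : ∀ {n k} → (Fin n → Fin n → Matrix k k) → Matrix (n ℕ.* k) (n ℕ.* k)
  fromBlocks {n} {k} B p q with remQuot {n} k p | remQuot {n} k q
  ... | i , a | j , b = B i j a b

  -- The entries of W at non-adjacent pairs carry no meaning: they are not
  -- constrained here and are never used below.
  record MatrixWeightedGraph (n k : ℕ) : Set (lsuc 0ℓ ⊔ c ⊔ ℓ₁ ⊔ ℓ₂) where
    infix 4 _∼_ _∼?_
    field
      _∼_       : Rel (Fin n) 0ℓ
      _∼?_      : Decidable _∼_
      ∼-sym     : Symmetric _∼_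
      ∼-irrefl  : ∀ {i} → ¬ (i ∼ i)
      connected : ∀ i j → Star _∼_ i j
      W         : Fin n → Fin n → Matrix k k
      W-sym     : ∀ {i j} → i ∼ j → W i j ≈ᴹ W j i
      W-posDef  : ∀ {i j} → i ∼ j → IsPositiveDefinite (W i j)

  module _ {n k : ℕ} (G : MatrixWeightedGraph n k) where

    open MatrixWeightedGraph G

    -- The inverses of the weights are determined up to `_≈ᴹ_` on edges.
    AreWeightInverses : (Fin n → Fin n → Matrix k k) → Set ℓ₁
    AreWeightInverses W⁻¹ = ∀ {i j} → i ∼ j → IsInverse (W i j) (W⁻¹ i j)

    module _ (W⁻¹ : Fin n → Fin n → Matrix k k) where

      -- W⁻¹ i j if i and j are adjacent, and 0 otherwise.
      edgeBlock : Fin n → Fin n → Matrix k k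
      edgeBlock i j a b with i ∼? j
      ... | yes _ = W⁻¹ i j a b
      ... | no  _ = 0#

      laplacianBlock : Fin n → Fin n → Matrix k k
      laplacianBlock i j a b with i Fin.≟ j
      ... | yes _ = sumᴹ (λ l → edgeBlock i l) a b
      ... | no  _ = - edgeBlock i j a b

      laplacian : Matrix (n ℕ.* k) (n ℕ.* k)
      laplacian = fromBlocks laplacianBlock

  -- C stands for a (1)-inverse of the Laplacian.
  resistanceBlock : ∀ {n k} → Matrix (n ℕ.* k) (n ℕ.* k) → Fin n → Fin n → Matrix k k
  resistanceBlock {n} {k} C i j a b =
    C[ i , i ] + C[ j , j ] - C[ i , j ] - C[ j , i ]
    where
    C[_,_] : Fin n → Fin n → Carrier
    C[ r , s ] = block C r s a b

  resistanceMatrix : ∀ {n k} → Matrix (n ℕ.* k) (n ℕ.* k) → Matrix (n ℕ.* k) (n ℕ.* k)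
  resistanceMatrix {n} {k} C = fromBlocks {n} {k} (resistanceBlock {n} {k} C)

  kirchhoffIndex : ∀ {n k} → Matrix (n ℕ.* k) (n ℕ.* k) → Matrix k k
  kirchhoffIndex {n} {k} C a b =
    ½ * sumᴹ (λ i → sumᴹ (λ j → block {n} {k} (resistanceMatrix {n} {k} C) i j)) a b

  infixr 8 _·ᴹ_

  _·ᴹ_ : ∀ {l m} → ℕ → Matrix l m → Matrix l m
  (n ·ᴹ A) a b = n · A a b

{-# OPTIONS --safe #-}
-- Two facts about the kernel of L drive the proof. It contains every vector with equal
-- blocks, since the block rows of L sum to 0, and it contains no others, since for Lx = 0 the
-- energy ∑ᵢⱼ (xᵢ − xⱼ)ᵀ Wᵢⱼ⁻¹ (xᵢ − xⱼ) vanishes, each term is non-negative and G is connected.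
-- The second fact makes R depend on the (1)-inverse C only through L⁺ (L C L) L⁺ = L⁺; by the
-- first, the columns of L⁺ = L (L⁺)ᵀ L⁺ have block sums 0. Hence in ∑ᵢⱼ (L⁺ᵢᵢ + L⁺ⱼⱼ − L⁺ᵢⱼ − L⁺ⱼᵢ)
-- only the diagonal terms survive, each counted n times.
module Submission where

open import Defs
open import Data.Nat.Base using (ℕ; _*_)
open import Data.Fin.Base using (Fin)

import Algebra.Properties.Ring as RingProperties
import Algebra.Properties.Semiring.Sum as SemiringSum
import Algebra.Solver.CommutativeMonoid as CommutativeMonoidSolver
open import Algebra.Bundles using (CommutativeRing)
open import Data.Fin.Base using (zero; suc; combine; remQuot; _↑ˡ_; _↑ʳ_)
import Data.Fin.Properties as Fin
open import Data.Nat.Base using (zero; suc; _+_)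
open import Data.Product.Base using (_,_; proj₁; proj₂)
open import Data.Sum.Base using (inj₁; inj₂)
open import Data.Vec.Functional using (Vector)
open import Function.Base using (_∘_)
open import Relation.Binary.Construct.Closure.ReflexiveTransitive using (Star; ε; _◅_)
open import Relation.Binary.PropositionalEquality.Core as ≡ using (_≡_; _≢_)
import Relation.Binary.Reasoning.Setoid as SetoidReasoning
open import Relation.Nullary.Decidable.Core using (Dec; yes; no)
open import Relation.Nullary.Negation.Core using (¬_; contradiction)

-- Differences and finite sums in a commutative ring.

module RingSums {c ℓ} (R : CommutativeRing c ℓ) where

  open CommutativeRing R hiding (zero) renaming (_*_ to _⊛_; _+_ to _⊕_)
  open RingProperties ring
  open SemiringSum semiring
  open SetoidReasoning setoid

  x-0≈x : ∀ x → x - 0# ≈ x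
  x-0≈x x = trans (+-congˡ -0#≈0#) (+-identityʳ x)

  [x-y]+[y-z]≈x-z : ∀ x y z → (x - y) ⊕ (y - z) ≈ x - z
  [x-y]+[y-z]≈x-z x y z = begin
    (x - y) ⊕ (y - z)       ≈⟨ +-assoc _ _ _ ⟩
    x ⊕ (- y ⊕ (y - z))     ≈⟨ +-congˡ (+-assoc _ _ _) ⟨
    x ⊕ ((- y ⊕ y) - z)     ≈⟨ +-congˡ (+-congʳ (-‿inverseˡ y)) ⟩
    x ⊕ (0# - z)            ≈⟨ +-congˡ (+-identityˡ _) ⟩
    x - z                   ∎

  -- Serves to turn "the blocks of a column of `A - B` agree" into "`A` and `B` have the same row
  -- differences".
  x-y≈z-w⇒x-z≈y-w : ∀ {x y z w} → x - y ≈ z - w → x - z ≈ y - w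
  x-y≈z-w⇒x-z≈y-w {x} {y} {z} {w} eq = begin
    x - z               ≈⟨ [x-y]+[y-z]≈x-z x y z ⟨
    (x - y) ⊕ (y - z)   ≈⟨ +-congʳ eq ⟩
    (z - w) ⊕ (y - z)   ≈⟨ +-comm _ _ ⟩
    (y - z) ⊕ (z - w)   ≈⟨ [x-y]+[y-z]≈x-z y z w ⟩
    y - w               ∎

  x+y≈z⇒x≈z-y : ∀ {x y z} → x ⊕ y ≈ z → x ≈ z - y
  x+y≈z⇒x≈z-y {x} {y} {z} eq = begin
    x               ≈⟨ +-identityʳ x ⟨
    x ⊕ 0#          ≈⟨ +-congˡ (-‿inverseʳ y) ⟨
    x ⊕ (y - y)     ≈⟨ +-assoc x y (- y) ⟨
    x ⊕ y - y       ≈⟨ +-congʳ eq ⟩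
    z - y           ∎

  x-y-z≈x-z-y : ∀ x y z → x - y - z ≈ x - z - y
  x-y-z≈x-z-y x y z = solve 3 (λ x y z → (x ⊞ y) ⊞ z ⊜ (x ⊞ z) ⊞ y) refl x (- y) (- z)
    where open CommutativeMonoidSolver +-commutativeMonoid renaming (_⊕_ to _⊞_)

  x+y-z-w≈[x-w]+[y-z] : ∀ x y z w → x ⊕ y - z - w ≈ (x - w) ⊕ (y - z)
  x+y-z-w≈[x-w]+[y-z] x y z w =
    solve 4 (λ x y z w → ((x ⊞ y) ⊞ z) ⊞ w ⊜ (x ⊞ w) ⊞ (y ⊞ z)) refl x y (- z) (- w)
    where open CommutativeMonoidSolver +-commutativeMonoid renaming (_⊕_ to _⊞_)

  ∑-zero : ∀ {n} {f : Vector Carrier n} → (∀ i → f i ≈ 0#) → sum f ≈ 0#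
  ∑-zero {n} f≈0 = trans (sum-cong-≋ f≈0) (sum-replicate-zero n)

  ∑-neg : ∀ {n} (f : Vector Carrier n) → ∑[ i < n ] (- f i) ≈ - ∑[ i < n ] f i
  ∑-neg {zero}  f = sym -0#≈0#
  ∑-neg {suc n} f = trans (+-congˡ (∑-neg (f ∘ suc))) (-‿+-comm _ _)

  ∑-distrib-minus : ∀ {n} (f g : Vector Carrier n) →
    ∑[ i < n ] (f i - g i) ≈ ∑[ i < n ] f i - ∑[ i < n ] g i
  ∑-distrib-minus f g = trans (∑-distrib-+ f (λ i → - g i)) (+-congˡ (∑-neg g))

  ∑-single : ∀ {n} (f : Vector Carrier n) i → (∀ j → i ≢ j → f j ≈ 0#) → sum f ≈ f i
  ∑-single f zero    f≈0 =
    trans (+-congˡ (∑-zero (λ j → f≈0 (suc j) λ ()))) (+-identityʳ _)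
  ∑-single f (suc i) f≈0 = trans
    (+-cong (f≈0 zero λ ())
            (∑-single (f ∘ suc) i (λ j i≢j → f≈0 (suc j) (i≢j ∘ Fin.suc-injective))))
    (+-identityˡ _)

  ∑-split : ∀ m {n} (f : Vector Carrier (m + n)) →
    sum f ≈ ∑[ i < m ] f (i ↑ˡ n) ⊕ ∑[ j < n ] f (m ↑ʳ j)
  ∑-split zero    f = sym (+-identityˡ _)
  ∑-split (suc m) f = trans (+-congˡ (∑-split m (f ∘ suc))) (sym (+-assoc _ _ _))

  ∑-combine : ∀ n k (f : Vector Carrier (n * k)) →
    sum f ≈ ∑[ i < n ] ∑[ a < k ] f (combine i a)
  ∑-combine zero    k f = refl
  ∑-combine (suc n) k f =
    trans (∑-split k f) (+-congˡ (∑-combine n k (λ p → f (k ↑ʳ p))))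

  -- Distributing splits the sum into potentials times outflows minus potentials times inflows.
  -- Outflows vanish by hypothesis, and by antisymmetry each inflow is the negative of an outflow.
  ∑-antisymmetric-flow : ∀ {n} (x : Vector Carrier n) (g : Fin n → Fin n → Carrier) →
    (∀ i j → g j i ≈ - g i j) → (∀ i → ∑[ j < n ] g i j ≈ 0#) →
    ∑[ i < n ] ∑[ j < n ] ((x i - x j) ⊛ g i j) ≈ 0#
  ∑-antisymmetric-flow {n} x g anti rows = begin
    ∑[ i < n ] ∑[ j < n ] ((x i - x j) ⊛ g i j)
      ≈⟨ sum-cong-≋ (λ i → trans (sum-cong-≋ (λ j → [y-z]x≈yx-zx (g i j) (x i) (x j)))
                                  (∑-distrib-minus (λ j → x i ⊛ g i j) (λ j → x j ⊛ g i j))) ⟩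
    ∑[ i < n ] (∑[ j < n ] (x i ⊛ g i j) - ∑[ j < n ] (x j ⊛ g i j))
      ≈⟨ ∑-distrib-minus (λ i → ∑[ j < n ] (x i ⊛ g i j)) (λ i → ∑[ j < n ] (x j ⊛ g i j)) ⟩
    ∑[ i < n ] ∑[ j < n ] (x i ⊛ g i j) - ∑[ i < n ] ∑[ j < n ] (x j ⊛ g i j)
      ≈⟨ +-cong (∑-zero outflow) (-‿cong (trans (∑-comm (λ i j → x j ⊛ g i j)) (∑-zero inflow))) ⟩
    0# - 0#
      ≈⟨ x-0≈x 0# ⟩
    0# ∎
    where
    outflow : ∀ i → ∑[ j < n ] (x i ⊛ g i j) ≈ 0#
    outflow i = begin
      ∑[ j < n ] (x i ⊛ g i j)   ≈⟨ *-distribˡ-sum (x i) (g i) ⟨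
      x i ⊛ ∑[ j < n ] g i j     ≈⟨ *-congˡ (rows i) ⟩
      x i ⊛ 0#                   ≈⟨ zeroʳ _ ⟩
      0#                         ∎
    inflow : ∀ j → ∑[ i < n ] (x j ⊛ g i j) ≈ 0#
    inflow j = begin
      ∑[ i < n ] (x j ⊛ g i j)     ≈⟨ sum-cong-≋ (λ i → *-congˡ (anti j i)) ⟩
      ∑[ i < n ] (x j ⊛ - g j i)   ≈⟨ sum-cong-≋ (λ i → -‿distribʳ-* (x j) (g j i)) ⟨
      ∑[ i < n ] (- (x j ⊛ g j i)) ≈⟨ ∑-neg (λ i → x j ⊛ g j i) ⟩
      - ∑[ i < n ] (x j ⊛ g j i)   ≈⟨ -‿cong (outflow j) ⟩
      - 0#                         ≈⟨ -0#≈0# ⟩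
      0#                           ∎

-- Non-negative numbers under an order that need not be decidable.

module OrderedField {c ℓ₁ ℓ₂} (ℝ : RealNumbers c ℓ₁ ℓ₂) where

  open RealNumbers ℝ hiding (zero) renaming (_*_ to _⊛_; _+_ to _⊕_)
  open RingSums commutativeRing
  open SemiringSum semiring
  open SetoidReasoning setoid

  -- ¬ (x < 0#) rather than 0# < x ⊎ 0# ≈ x, since the order need not be decidable.
  NonNegative : Carrier → Set ℓ₂
  NonNegative x = ¬ (x < 0#)

  <-respʳ : ∀ {x y z} → y ≈ z → x < y → x < z
  <-respʳ = proj₁ <-resp-≈

  ¬#⇒≈ : ∀ {x y} → ¬ (x # y) → x ≈ y
  ¬#⇒≈ {x} {y} = proj₁ (tight x y)

  nonNegative-resp : ∀ {x y} → x ≈ y → NonNegative x → NonNegative y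
  nonNegative-resp x≈y x≥0 y<0 = x≥0 (<-respˡ-≈ (sym x≈y) y<0)

  ≈0⇒nonNegative : ∀ {x} → x ≈ 0# → NonNegative x
  ≈0⇒nonNegative = <-irrefl

  x<x+y : ∀ x {y} → 0# < y → x < x ⊕ y
  x<x+y x 0<y = <-respʳ (+-comm _ x) (<-respˡ-≈ (+-identityˡ x) (+-monoˡ-< x 0<y))

  x+y<0⇒y<0 : ∀ {x y} → 0# < x → x ⊕ y < 0# → y < 0#
  x+y<0⇒y<0 {x} {y} 0<x x+y<0 = <-trans (<-respʳ (+-comm y x) (x<x+y y 0<x)) x+y<0

  -- In place of a case split on the sign of `x`, cotransitivity compares `x` with the two ends of
  -- `x ⊕ y < 0#`. Each of the four resulting strict inequalities makes `x` or `y` negative.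
  nonNegative-+ : ∀ {x y} → NonNegative x → NonNegative y → NonNegative (x ⊕ y)
  nonNegative-+ {x} {y} x≥0 y≥0 x+y<0 with #-cotrans (<⇒# x+y<0) x
  ... | inj₂ x#0 with #⇒<⊎> x#0
  ...   | inj₁ x<0 = x≥0 x<0
  ...   | inj₂ 0<x = y≥0 (x+y<0⇒y<0 0<x x+y<0)
  nonNegative-+ {x} {y} x≥0 y≥0 x+y<0 | inj₁ x+y#x with #⇒<⊎> x+y#x
  ...   | inj₂ x<x+y = x≥0 (<-trans x<x+y x+y<0)
  ...   | inj₁ x+y<x = y≥0 (<-respˡ-≈ y-eq (<-respʳ (-‿inverseʳ x) (+-monoˡ-< (- x) x+y<x)))
    where
    y-eq : x ⊕ y - x ≈ y
    y-eq = sym (x+y≈z⇒x≈z-y (+-comm y x))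

  -- By tightness it suffices to refute `x # 0#`; the case `0# < x` would give `y < y ⊕ x ≈ 0#`.
  nonNegative-+≈0ˡ : ∀ {x y} → NonNegative x → NonNegative y → x ⊕ y ≈ 0# → x ≈ 0#
  nonNegative-+≈0ˡ {x} {y} x≥0 y≥0 x+y≈0 = ¬#⇒≈ λ x#0 → refute (#⇒<⊎> x#0)
    where
    refute : ¬ _
    refute (inj₁ x<0) = x≥0 x<0
    refute (inj₂ 0<x) = y≥0 (<-respʳ (trans (+-comm y x) x+y≈0) (x<x+y y 0<x))

  ∑-nonNegative : ∀ {n} {f : Vector Carrier n} → (∀ i → NonNegative (f i)) → NonNegative (sum f)
  ∑-nonNegative {zero}  f≥0 = <-irrefl refl
  ∑-nonNegative {suc n} f≥0 = nonNegative-+ (f≥0 zero) (∑-nonNegative (f≥0 ∘ suc))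

  ∑-nonNegative≈0 : ∀ {n} {f : Vector Carrier n} → (∀ i → NonNegative (f i)) →
    sum f ≈ 0# → ∀ i → f i ≈ 0#
  ∑-nonNegative≈0 f≥0 ∑≈0 zero =
    nonNegative-+≈0ˡ (f≥0 zero) (∑-nonNegative (f≥0 ∘ suc)) ∑≈0
  ∑-nonNegative≈0 f≥0 ∑≈0 (suc i) = ∑-nonNegative≈0 (f≥0 ∘ suc)
    (nonNegative-+≈0ˡ (∑-nonNegative (f≥0 ∘ suc)) (f≥0 zero) (trans (+-comm _ _) ∑≈0)) i

  ½[x+x]≈x : ∀ x → ½ ⊛ (x ⊕ x) ≈ x
  ½[x+x]≈x x = begin
    ½ ⊛ (x ⊕ x)                   ≈⟨ *-congˡ (+-cong (*-identityˡ x) (*-identityˡ x)) ⟨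
    ½ ⊛ (1# ⊛ x ⊕ 1# ⊛ x)         ≈⟨ *-congˡ (distribʳ x 1# 1#) ⟨
    ½ ⊛ ((1# ⊕ 1#) ⊛ x)           ≈⟨ *-assoc _ _ _ ⟨
    -- `½` is the inverse that `#⇒invertible` yields for a difference of apart elements, here
    -- `1# ⊕ 1# - 0#`, so the zero has to be put back before cancelling.
    ½ ⊛ (1# ⊕ 1#) ⊛ x             ≈⟨ *-congʳ (*-congˡ (x-0≈x _)) ⟨
    ½ ⊛ (1# ⊕ 1# - 0#) ⊛ x        ≈⟨ *-congʳ (proj₁ (proj₂ (#⇒invertible (#-sym (<⇒# 0<2))))) ⟩
    1# ⊛ x                        ≈⟨ *-identityˡ x ⟩
    x                             ∎

-- Matrix algebra.

module Matrices {c ℓ₁ ℓ₂} (ℝ : RealNumbers c ℓ₁ ℓ₂) where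

  open RealNumbers ℝ hiding (zero) renaming (_*_ to _⊛_; _+_ to _⊕_)
  open MatrixWeighted ℝ
  open RingSums commutativeRing
  open OrderedField ℝ
  open SemiringSum semiring
  open SetoidReasoning setoid

  Iᴹ-diagonal : ∀ {m} (a : Fin m) → Iᴹ a a ≈ 1#
  Iᴹ-diagonal a with a Fin.≟ a
  ... | yes _   = refl
  ... | no  a≢a = contradiction ≡.refl a≢a

  Iᴹ-offDiagonal : ∀ {m} {a b : Fin m} → a ≢ b → Iᴹ a b ≈ 0#
  Iᴹ-offDiagonal {a = a} {b} a≢b with a Fin.≟ b
  ... | yes a≡b = contradiction a≡b a≢b
  ... | no  _   = refl

  Iᴹ-symmetric : ∀ {m} → IsSymmetric (Iᴹ {m})
  Iᴹ-symmetric a b with a Fin.≟ b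
  ... | yes ≡.refl = Iᴹ-diagonal a
  ... | no  a≢b    = Iᴹ-offDiagonal (a≢b ∘ ≡.sym)

  ≈ᴹ-sym : ∀ {m n} {A B : Matrix m n} → A ≈ᴹ B → B ≈ᴹ A
  ≈ᴹ-sym A≈B a b = sym (A≈B a b)

  ≈ᴹ-trans : ∀ {m n} {A B C : Matrix m n} → A ≈ᴹ B → B ≈ᴹ C → A ≈ᴹ C
  ≈ᴹ-trans A≈B B≈C a b = trans (A≈B a b) (B≈C a b)

  *ᴹ-cong : ∀ {l m n} {A A′ : Matrix l m} {B B′ : Matrix m n} →
    A ≈ᴹ A′ → B ≈ᴹ B′ → A *ᴹ B ≈ᴹ A′ *ᴹ B′
  *ᴹ-cong A≈A′ B≈B′ a b = sum-cong-≋ (λ d → *-cong (A≈A′ a d) (B≈B′ d b))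

  *ᴹ-congˡ : ∀ {l m n} (A : Matrix l m) {B B′ : Matrix m n} →
    B ≈ᴹ B′ → A *ᴹ B ≈ᴹ A *ᴹ B′
  *ᴹ-congˡ A = *ᴹ-cong {A = A} (λ _ _ → refl)

  *ᴹ-congʳ : ∀ {l m n} {A A′ : Matrix l m} (B : Matrix m n) →
    A ≈ᴹ A′ → A *ᴹ B ≈ᴹ A′ *ᴹ B
  *ᴹ-congʳ B A≈A′ = *ᴹ-cong {B = B} A≈A′ (λ _ _ → refl)

  *ᴹ-assoc : ∀ {l m n o} (A : Matrix l m) (B : Matrix m n) (C : Matrix n o) →
    A *ᴹ B *ᴹ C ≈ᴹ A *ᴹ (B *ᴹ C)
  *ᴹ-assoc {m = m} {n} A B C a b = begin
    ∑[ e < n ] (∑[ d < m ] (A a d ⊛ B d e) ⊛ C e b)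
      ≈⟨ sum-cong-≋ (λ e → *-distribʳ-sum (C e b) (λ d → A a d ⊛ B d e)) ⟩
    ∑[ e < n ] ∑[ d < m ] (A a d ⊛ B d e ⊛ C e b)
      ≈⟨ ∑-comm (λ e d → A a d ⊛ B d e ⊛ C e b) ⟩
    ∑[ d < m ] ∑[ e < n ] (A a d ⊛ B d e ⊛ C e b)
      ≈⟨ sum-cong-≋ (λ d → trans (sum-cong-≋ (λ e → *-assoc (A a d) (B d e) (C e b)))
                                  (sym (*-distribˡ-sum (A a d) (λ e → B d e ⊛ C e b)))) ⟩
    ∑[ d < m ] (A a d ⊛ ∑[ e < n ] (B d e ⊛ C e b)) ∎

  ᵀ-*ᴹ : ∀ {l m n} (A : Matrix l m) (B : Matrix m n) → (A *ᴹ B) ᵀ ≈ᴹ B ᵀ *ᴹ A ᵀ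
  ᵀ-*ᴹ A B a b = sum-cong-≋ (λ d → *-comm (A b d) (B d a))

  *ᴹ-identityˡ : ∀ {m n} (A : Matrix m n) → Iᴹ *ᴹ A ≈ᴹ A
  *ᴹ-identityˡ A a b = begin
    (Iᴹ *ᴹ A) a b     ≈⟨ ∑-single _ a (λ d a≢d → trans (*-congʳ (Iᴹ-offDiagonal a≢d)) (zeroˡ _)) ⟩
    Iᴹ a a ⊛ A a b    ≈⟨ *-congʳ (Iᴹ-diagonal a) ⟩
    1# ⊛ A a b        ≈⟨ *-identityˡ _ ⟩
    A a b             ∎

  *ᴹ-identityʳ : ∀ {m n} (A : Matrix m n) → A *ᴹ Iᴹ ≈ᴹ A
  *ᴹ-identityʳ A a b = begin
    (A *ᴹ Iᴹ) a b      ≈⟨ ᵀ-*ᴹ A Iᴹ b a ⟩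
    (Iᴹ ᵀ *ᴹ A ᵀ) b a  ≈⟨ *ᴹ-congʳ (A ᵀ) Iᴹ-symmetric b a ⟩
    (Iᴹ *ᴹ A ᵀ) b a    ≈⟨ *ᴹ-identityˡ (A ᵀ) b a ⟩
    A a b              ∎

  -- `B = B (A′ B′) = (B A) B′ = B′`. Allowing `A` and `A′` to be merely equal up to `≈ᴹ` carries
  -- both symmetries of the weights, `W i j ≈ᴹ W j i` and `W i j ᵀ ≈ᴹ W i j`, over to the chosen
  -- inverses.
  inverse-unique : ∀ {m} {A A′ B B′ : Matrix m m} →
    A ≈ᴹ A′ → IsInverse A B → IsInverse A′ B′ → B ≈ᴹ B′
  inverse-unique {A = A} {A′} {B} {B′} A≈A′ inv inv′ a b = begin
    B a b                  ≈⟨ *ᴹ-identityʳ B a b ⟨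
    (B *ᴹ Iᴹ) a b          ≈⟨ *ᴹ-congˡ B (IsInverse.inverseʳ inv′) a b ⟨
    (B *ᴹ (A′ *ᴹ B′)) a b  ≈⟨ *ᴹ-assoc B A′ B′ a b ⟨
    (B *ᴹ A′ *ᴹ B′) a b    ≈⟨ *ᴹ-congʳ B′ (*ᴹ-congˡ B A≈A′) a b ⟨
    (B *ᴹ A *ᴹ B′) a b     ≈⟨ *ᴹ-congʳ B′ (IsInverse.inverseˡ inv) a b ⟩
    (Iᴹ *ᴹ B′) a b         ≈⟨ *ᴹ-identityˡ B′ a b ⟩
    B′ a b                 ∎

  ᵀ-inverse : ∀ {m} {A B : Matrix m m} → IsInverse A B → IsInverse (A ᵀ) (B ᵀ)
  ᵀ-inverse {A = A} {B} inv = record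
    { inverseˡ = λ a b → trans (sym (ᵀ-*ᴹ A B a b)) (trans (inverseʳ b a) (Iᴹ-symmetric a b))
    ; inverseʳ = λ a b → trans (sym (ᵀ-*ᴹ B A a b)) (trans (inverseˡ b a) (Iᴹ-symmetric a b))
    }
    where open IsInverse inv

  -- Quadratic forms and positive definiteness.

  ¬nonZero⇒≈0 : ∀ {m} {x : Vector Carrier m} → ¬ NonZeroVector x → ∀ a → x a ≈ 0#
  ¬nonZero⇒≈0 x-zero a = ¬#⇒≈ (λ xa#0 → x-zero (a , xa#0))

  quadraticForm-zero : ∀ {m} (A : Matrix m m) {x} → (∀ a → x a ≈ 0#) → quadraticForm A x ≈ 0#
  quadraticForm-zero {m} A x≈0 = ∑-zero {m} λ a → ∑-zero {m} λ b → trans (*-congˡ (x≈0 b)) (zeroʳ _)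

  infixl 7 _*ⱽ_

  _*ⱽ_ : ∀ {m n} → Matrix m n → Vector Carrier n → Vector Carrier m
  _*ⱽ_ {n = n} A x a = ∑[ b < n ] (A a b ⊛ x b)

  quadraticForm-*ⱽ : ∀ {m} (A : Matrix m m) x →
    ∑[ a < m ] ((A *ⱽ x) a ⊛ x a) ≈ quadraticForm A x
  quadraticForm-*ⱽ A x = sum-cong-≋ λ a → begin
    (A *ⱽ x) a ⊛ x a                   ≈⟨ *-comm _ _ ⟩
    x a ⊛ (A *ⱽ x) a                   ≈⟨ *-distribˡ-sum (x a) (λ b → A a b ⊛ x b) ⟩
    ∑[ b < _ ] (x a ⊛ (A a b ⊛ x b))   ≈⟨ sum-cong-≋ (λ b → *-assoc (x a) (A a b) (x b)) ⟨
    ∑[ b < _ ] (x a ⊛ A a b ⊛ x b)     ∎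

  inverse-*ⱽ : ∀ {m} {A B : Matrix m m} → IsInverse A B → ∀ x a → (A *ⱽ (B *ⱽ x)) a ≈ x a
  inverse-*ⱽ {m} {A} {B} inv x a = begin
    (A *ⱽ (B *ⱽ x)) a   ≈⟨ *ᴹ-assoc A B X a zero ⟨
    (A *ᴹ B *ᴹ X) a zero ≈⟨ *ᴹ-congʳ X (IsInverse.inverseʳ inv) a zero ⟩
    (Iᴹ *ᴹ X) a zero    ≈⟨ *ᴹ-identityˡ X a zero ⟩
    x a                 ∎
    where
    -- The vector as a one-column matrix, so that the laws of the matrix product apply.
    X : Matrix m 1
    X b _ = x b

  module PositiveDefinite {m} {A : Matrix m m} (A>0 : IsPositiveDefinite A) where

    open IsPositiveDefinite A>0

    -- Whether `x` is nonzero cannot be decided. But a negative value rules out a nonzero `x`, whose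
    -- value is positive; then all entries vanish by tightness, and so does the value.
    form-nonNegative : ∀ x → NonNegative (quadraticForm A x)
    form-nonNegative x q<0 = <-irrefl (quadraticForm-zero A (¬nonZero⇒≈0 x-zero)) q<0
      where
      x-zero : ¬ NonZeroVector x
      x-zero x≢0 = <-irrefl refl (<-trans q<0 (positive x x≢0))

    form≈0⇒≈0 : ∀ x → quadraticForm A x ≈ 0# → ∀ a → x a ≈ 0#
    form≈0⇒≈0 x q≈0 = ¬nonZero⇒≈0 λ x≢0 → <-irrefl (sym q≈0) (positive x x≢0)

  -- Block matrices and resistance blocks.

  block-fromBlocks : ∀ {n k} (B : Fin n → Fin n → Matrix k k) i j a b →
    block (fromBlocks B) i j a b ≡ B i j a b
  block-fromBlocks {n} {k} B i j a b =
    ≡.cong₂ (λ (i , a) (j , b) → B i j a b) (Fin.remQuot-combine i a) (Fin.remQuot-combine j b)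

  fromBlocks-symmetric : ∀ {n k} (B : Fin n → Fin n → Matrix k k) →
    (∀ i j → B j i ᵀ ≈ᴹ B i j) → IsSymmetric (fromBlocks B)
  fromBlocks-symmetric {n} {k} B B-sym p q = B-sym _ _ _ _

  -- Equivalently, every column of `A - B` has equal blocks, as vectors in the kernel of the
  -- Laplacian do.
  SameRowDifferences : ∀ {n k} → Matrix (n * k) (n * k) → Matrix (n * k) (n * k) → Set _
  SameRowDifferences {n} {k} A B = ∀ (i j : Fin n) (a : Fin k) q →
    A (combine i a) q - A (combine j a) q ≈ B (combine i a) q - B (combine j a) q

  -- The four terms regroup as `(Cᵢᵢ - Cⱼᵢ) ⊕ (Cⱼⱼ - Cᵢⱼ)`, and each bracket is a difference of two
  -- rows within a single column.
  resistanceBlock-row : ∀ {n k} (A B : Matrix (n * k) (n * k)) → SameRowDifferences {n} {k} A B →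
    ∀ i j → resistanceBlock {n} {k} A i j ≈ᴹ resistanceBlock {n} {k} B i j
  resistanceBlock-row {n} {k} A B A~B i j a b = begin
    resistanceBlock {n} {k} A i j a b
      ≈⟨ regroup A ⟩
    (block A i i a b - block A j i a b) ⊕ (block A j j a b - block A i j a b)
      ≈⟨ +-cong (A~B i j a (combine i b)) (A~B j i a (combine j b)) ⟩
    (block B i i a b - block B j i a b) ⊕ (block B j j a b - block B i j a b)
      ≈⟨ regroup B ⟨
    resistanceBlock {n} {k} B i j a b ∎
    where
    regroup : ∀ C → resistanceBlock {n} {k} C i j a b ≈
      (block C i i a b - block C j i a b) ⊕ (block C j j a b - block C i j a b)
    regroup C = x+y-z-w≈[x-w]+[y-z] _ _ _ _

  -- Transposing only exchanges the two subtracted terms, so statements about row differences also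
  -- serve for column differences.
  resistanceBlock-ᵀ : ∀ {n k} (C : Matrix (n * k) (n * k)) i j a b →
    resistanceBlock {n} {k} (C ᵀ) i j a b ≈ resistanceBlock {n} {k} C i j b a
  resistanceBlock-ᵀ C i j a b = x-y-z≈x-z-y _ _ _

-- The Laplacian: symmetry, action on vectors, vanishing block sums.

module Laplacian {c ℓ₁ ℓ₂} (ℝ : RealNumbers c ℓ₁ ℓ₂) {n k : ℕ}
  (G : MatrixWeighted.MatrixWeightedGraph ℝ n k)
  (W⁻¹ : Fin n → Fin n → MatrixWeighted.Matrix ℝ k k)
  (W⁻¹-inverse : MatrixWeighted.AreWeightInverses ℝ G W⁻¹) where

  open MatrixWeighted ℝ
  open RealNumbers ℝ hiding (zero) renaming (_*_ to _⊛_; _+_ to _⊕_)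
  open MatrixWeightedGraph G
  open RingSums commutativeRing
  open OrderedField ℝ
  open Matrices ℝ
  open SemiringSum semiring
  open RingProperties (CommutativeRing.ring commutativeRing)
  open SetoidReasoning setoid

  private
    L : Matrix (n * k) (n * k)
    L = laplacian G W⁻¹

    edge : Fin n → Fin n → Matrix k k
    edge = edgeBlock G W⁻¹

  edge-adjacent : ∀ {i j} → i ∼ j → edge i j ≈ᴹ W⁻¹ i j
  edge-adjacent {i} {j} i∼j a b with i ∼? j
  ... | yes _   = refl
  ... | no  i≁j = contradiction i∼j i≁j

  edge-nonadjacent : ∀ {i j} → ¬ (i ∼ j) → ∀ a b → edge i j a b ≈ 0#
  edge-nonadjacent {i} {j} i≁j a b with i ∼? j
  ... | yes i∼j = contradiction i∼j i≁j
  ... | no  _   = refl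

  edge-swap : ∀ i j → edge j i ≈ᴹ edge i j
  edge-swap i j a b with i ∼? j
  ... | yes i∼j = trans (edge-adjacent (∼-sym i∼j) a b)
    (inverse-unique (W-sym (∼-sym i∼j)) (W⁻¹-inverse (∼-sym i∼j)) (W⁻¹-inverse i∼j) a b)
  ... | no  i≁j = edge-nonadjacent (i≁j ∘ ∼-sym) a b

  edge-symmetric : ∀ i j → IsSymmetric (edge i j)
  edge-symmetric i j a b with i ∼? j
  ... | yes i∼j = inverse-unique (IsPositiveDefinite.symmetric (W-posDef i∼j))
    (ᵀ-inverse (W⁻¹-inverse i∼j)) (W⁻¹-inverse i∼j) a b
  ... | no  _   = refl

  laplacianBlock-diagonal : ∀ i a b → laplacianBlock G W⁻¹ i i a b ≈ ∑[ l < n ] edge i l a b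
  laplacianBlock-diagonal i a b with i Fin.≟ i
  ... | yes _   = refl
  ... | no  i≢i = contradiction ≡.refl i≢i

  laplacianBlock-offDiagonal : ∀ {i j} → i ≢ j → ∀ a b →
    laplacianBlock G W⁻¹ i j a b ≈ - edge i j a b
  laplacianBlock-offDiagonal {i} {j} i≢j a b with i Fin.≟ j
  ... | yes i≡j = contradiction i≡j i≢j
  ... | no  _   = refl

  laplacian-symmetric : IsSymmetric L
  laplacian-symmetric = fromBlocks-symmetric (laplacianBlock G W⁻¹) symm
    where
    symm : ∀ i j a b → laplacianBlock G W⁻¹ j i b a ≈ laplacianBlock G W⁻¹ i j a b
    symm i j a b with i Fin.≟ j
    ... | yes ≡.refl = trans (laplacianBlock-diagonal i b a)
      (sum-cong-≋ (λ l → edge-symmetric i l a b))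
    ... | no  i≢j    = trans (laplacianBlock-offDiagonal (i≢j ∘ ≡.sym) b a)
      (-‿cong (trans (edge-swap i j b a) (edge-symmetric i j a b)))

  -- The Laplacian as a difference operator, at a fixed entry `a b` of the blocks. Adding
  -- `∑ⱼ B j ⊛ x j` cancels every term with `j ≢ i`; what is left is the diagonal block, itself the
  -- sum of the `B j`, times `x i`.
  laplacianBlock-action : ∀ i a b (x : Vector Carrier n) →
    ∑[ j < n ] (laplacianBlock G W⁻¹ i j a b ⊛ x j) ≈ ∑[ j < n ] (edge i j a b ⊛ (x i - x j))
  laplacianBlock-action i a b x = begin
    ∑[ j < n ] (Λ j ⊛ x j)
      ≈⟨ x+y≈z⇒x≈z-y total ⟩
    ∑[ j < n ] (B j ⊛ x i) - ∑[ j < n ] (B j ⊛ x j)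
      ≈⟨ ∑-distrib-minus (λ j → B j ⊛ x i) (λ j → B j ⊛ x j) ⟨
    ∑[ j < n ] (B j ⊛ x i - B j ⊛ x j)
      ≈⟨ sum-cong-≋ (λ j → x[y-z]≈xy-xz (B j) (x i) (x j)) ⟨
    ∑[ j < n ] (B j ⊛ (x i - x j)) ∎
    where
    Λ B : Vector Carrier n
    Λ j = laplacianBlock G W⁻¹ i j a b
    B j = edge i j a b

    off : ∀ j → i ≢ j → Λ j ⊛ x j ⊕ B j ⊛ x j ≈ 0#
    off j i≢j = begin
      Λ j ⊛ x j ⊕ B j ⊛ x j   ≈⟨ distribʳ (x j) (Λ j) (B j) ⟨
      (Λ j ⊕ B j) ⊛ x j       ≈⟨ *-congʳ (+-congʳ (laplacianBlock-offDiagonal i≢j a b)) ⟩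
      (- B j ⊕ B j) ⊛ x j     ≈⟨ *-congʳ (-‿inverseˡ (B j)) ⟩
      0# ⊛ x j                ≈⟨ zeroˡ (x j) ⟩
      0#                      ∎

    total : ∑[ j < n ] (Λ j ⊛ x j) ⊕ ∑[ j < n ] (B j ⊛ x j) ≈ ∑[ j < n ] (B j ⊛ x i)
    total = begin
      ∑[ j < n ] (Λ j ⊛ x j) ⊕ ∑[ j < n ] (B j ⊛ x j)
        ≈⟨ ∑-distrib-+ (λ j → Λ j ⊛ x j) (λ j → B j ⊛ x j) ⟨
      ∑[ j < n ] (Λ j ⊛ x j ⊕ B j ⊛ x j)
        ≈⟨ ∑-single _ i off ⟩
      Λ i ⊛ x i ⊕ B i ⊛ x i
        -- There are no loops, so `B i` has the default value 0.
        ≈⟨ +-congˡ (trans (*-congʳ (edge-nonadjacent ∼-irrefl a b)) (zeroˡ (x i))) ⟩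
      Λ i ⊛ x i ⊕ 0#
        ≈⟨ +-identityʳ _ ⟩
      Λ i ⊛ x i
        ≈⟨ *-congʳ (laplacianBlock-diagonal i a b) ⟩
      ∑[ j < n ] B j ⊛ x i
        ≈⟨ *-distribʳ-sum (x i) B ⟩
      ∑[ j < n ] (B j ⊛ x i) ∎

  block-laplacian : ∀ i j a b → block L i j a b ≈ laplacianBlock G W⁻¹ i j a b
  block-laplacian i j a b = reflexive (block-fromBlocks (laplacianBlock G W⁻¹) i j a b)

  -- The row sum is the action on the constant vector 1, all of whose differences vanish.
  laplacian-rowSum : ∀ i a b → ∑[ j < n ] block L i j a b ≈ 0#
  laplacian-rowSum i a b = begin
    ∑[ j < n ] block L i j a b
      ≈⟨ sum-cong-≋ (λ j → trans (block-laplacian i j a b) (sym (*-identityʳ _))) ⟩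
    ∑[ j < n ] (laplacianBlock G W⁻¹ i j a b ⊛ 1#)
      ≈⟨ laplacianBlock-action i a b (λ _ → 1#) ⟩
    ∑[ j < n ] (edge i j a b ⊛ (1# - 1#))
      ≈⟨ ∑-zero {n} (λ j → trans (*-congˡ (-‿inverseʳ 1#)) (zeroʳ _)) ⟩
    0# ∎

  laplacian-columnSum : ∀ a q → ∑[ i < n ] L (combine i a) q ≈ 0#
  -- Writing `q` as `combine j b` exposes the block structure of the column, which by symmetry of
  -- `L` is a row.
  laplacian-columnSum a q = ≡.subst (λ q → ∑[ i < n ] L (combine i a) q ≈ 0#)
    (Fin.combine-remQuot {n} k q)
    (trans (sum-cong-≋ {n} (λ i → laplacian-symmetric (combine j b) (combine i a)))
           (laplacian-rowSum j b a))
    where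
    j = proj₁ (remQuot {n} k q)
    b = proj₂ (remQuot {n} k q)

  -- The energy ∑ᵢⱼ (xᵢ − xⱼ)ᵀ gᵢⱼ vanishes because the flow g is antisymmetric and has
  -- no sources. On an edge the flow determines the potential drop by xᵢ − xⱼ = Wᵢⱼ gᵢⱼ,
  -- so the energy of the edge is the value of the form of Wᵢⱼ at gᵢⱼ.
  module Kernel (y : Vector Carrier (n * k)) (Ly≈0 : ∀ p → (L *ⱽ y) p ≈ 0#) where

    x : Fin n → Vector Carrier k
    x i a = y (combine i a)

    drop : Fin n → Fin n → Vector Carrier k
    drop i j a = x i a - x j a

    flow : Fin n → Fin n → Vector Carrier k
    flow i j = edge i j *ⱽ drop i j

    flow-antisymmetric : ∀ a i j → flow j i a ≈ - flow i j a
    flow-antisymmetric a i j = begin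
      ∑[ b < k ] (edge j i a b ⊛ drop j i b)
        ≈⟨ sum-cong-≋ (λ b → *-cong (edge-swap i j a b) (sym (⁻¹-anti-homo‿- (x i b) (x j b)))) ⟩
      ∑[ b < k ] (edge i j a b ⊛ - drop i j b)
        ≈⟨ sum-cong-≋ (λ b → -‿distribʳ-* (edge i j a b) (drop i j b)) ⟨
      ∑[ b < k ] (- (edge i j a b ⊛ drop i j b))
        ≈⟨ ∑-neg (λ b → edge i j a b ⊛ drop i j b) ⟩
      - flow i j a ∎

    -- The net flow out of vertex `i` is block `i` of `L *ⱽ y`.
    flow-conserved : ∀ a i → ∑[ j < n ] flow i j a ≈ 0#
    flow-conserved a i = begin
      ∑[ j < n ] ∑[ b < k ] (edge i j a b ⊛ drop i j b)
        ≈⟨ ∑-comm (λ j b → edge i j a b ⊛ drop i j b) ⟩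
      ∑[ b < k ] ∑[ j < n ] (edge i j a b ⊛ drop i j b)
        ≈⟨ sum-cong-≋ (λ b → laplacianBlock-action i a b (λ j → x j b)) ⟨
      ∑[ b < k ] ∑[ j < n ] (laplacianBlock G W⁻¹ i j a b ⊛ x j b)
        ≈⟨ ∑-comm (λ j b → laplacianBlock G W⁻¹ i j a b ⊛ x j b) ⟨
      ∑[ j < n ] ∑[ b < k ] (laplacianBlock G W⁻¹ i j a b ⊛ x j b)
        ≈⟨ sum-cong-≋ {n} (λ j → sum-cong-≋ {k} (λ b → *-congʳ (block-laplacian i j a b))) ⟨
      ∑[ j < n ] ∑[ b < k ] (L (combine i a) (combine j b) ⊛ y (combine j b))
        ≈⟨ ∑-combine n k (λ q → L (combine i a) q ⊛ y q) ⟨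
      (L *ⱽ y) (combine i a)
        ≈⟨ Ly≈0 (combine i a) ⟩
      0# ∎

    energy : Fin n → Fin n → Carrier
    energy i j = ∑[ a < k ] (drop i j a ⊛ flow i j a)

    ∑-energy≈0 : ∑[ i < n ] ∑[ j < n ] energy i j ≈ 0#
    ∑-energy≈0 = begin
      ∑[ i < n ] ∑[ j < n ] ∑[ a < k ] (drop i j a ⊛ flow i j a)
        ≈⟨ sum-cong-≋ (λ i → ∑-comm (λ j a → drop i j a ⊛ flow i j a)) ⟩
      ∑[ i < n ] ∑[ a < k ] ∑[ j < n ] (drop i j a ⊛ flow i j a)
        ≈⟨ ∑-comm (λ i a → ∑[ j < n ] (drop i j a ⊛ flow i j a)) ⟩
      ∑[ a < k ] ∑[ i < n ] ∑[ j < n ] (drop i j a ⊛ flow i j a)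
        -- With the coordinate `a` outermost, the scalar statement about flows applies to each
        -- coordinate separately.
        ≈⟨ ∑-zero {k} (λ a → ∑-antisymmetric-flow (λ i → x i a) (λ i j → flow i j a)
                               (flow-antisymmetric a) (flow-conserved a)) ⟩
      0# ∎

    drop≈W*flow : ∀ {i j} → i ∼ j → ∀ a → (W i j *ⱽ flow i j) a ≈ drop i j a
    drop≈W*flow {i} {j} i∼j a = trans
      (sum-cong-≋ {k} (λ b → *-congˡ (sum-cong-≋ {k} (λ d → *-congʳ (edge-adjacent i∼j b d)))))
      (inverse-*ⱽ (W⁻¹-inverse i∼j) (drop i j) a)

    -- Using the form of `W i j` makes its positive definiteness available directly, with no need to
    -- establish it for `W⁻¹ i j`.
    energy≈form : ∀ {i j} → i ∼ j → energy i j ≈ quadraticForm (W i j) (flow i j)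
    energy≈form {i} {j} i∼j = trans
      (sum-cong-≋ {k} (λ a → *-congʳ (sym (drop≈W*flow i∼j a))))
      (quadraticForm-*ⱽ (W i j) (flow i j))

    energy-nonNegative : ∀ i j → NonNegative (energy i j)
    energy-nonNegative i j = byAdjacency (i ∼? j)
      where
      byAdjacency : Dec (i ∼ j) → NonNegative (energy i j)
      byAdjacency (yes i∼j) = nonNegative-resp (sym (energy≈form i∼j))
        (PositiveDefinite.form-nonNegative (W-posDef i∼j) (flow i j))
      byAdjacency (no  i≁j) = ≈0⇒nonNegative (∑-zero {k} (λ a →
        trans (*-congˡ (∑-zero {k} (λ b → trans (*-congʳ (edge-nonadjacent i≁j a b)) (zeroˡ _))))
              (zeroʳ _)))

    energy≈0 : ∀ i j → energy i j ≈ 0#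
    energy≈0 i = ∑-nonNegative≈0 (energy-nonNegative i)
      (∑-nonNegative≈0 (λ i → ∑-nonNegative (energy-nonNegative i)) ∑-energy≈0 i)

    -- Zero energy forces zero flow by definiteness of `W i j`, and the drop is `W i j` applied to
    -- the flow.
    adjacent-equal : ∀ {i j} → i ∼ j → ∀ a → x i a ≈ x j a
    adjacent-equal {i} {j} i∼j a = x∙y⁻¹≈ε⇒x≈y (x i a) (x j a) (begin
      drop i j a                  ≈⟨ drop≈W*flow i∼j a ⟨
      (W i j *ⱽ flow i j) a       ≈⟨ ∑-zero {k} (λ b → trans (*-congˡ (flow≈0 b)) (zeroʳ _)) ⟩
      0#                          ∎)
      where
      flow≈0 : ∀ b → flow i j b ≈ 0#
      flow≈0 = PositiveDefinite.form≈0⇒≈0 (W-posDef i∼j) (flow i j)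
        (trans (sym (energy≈form i∼j)) (energy≈0 i j))

    -- Connectedness enters here: equality passes along a walk from `i` to `j`.
    blocks-equal : ∀ i j a → x i a ≈ x j a
    blocks-equal i j a = along (connected i j)
      where
      along : ∀ {i j} → Star _∼_ i j → x i a ≈ x j a
      along ε         = refl
      along (i∼l ◅ w) = trans (adjacent-equal i∼l a) (along w)

  -- Matrices with equal products by the Laplacian.

  equalImages⇒sameRowDifferences : ∀ {A B : Matrix (n * k) (n * k)} →
    L *ᴹ A ≈ᴹ L *ᴹ B → SameRowDifferences {n} {k} A B
  equalImages⇒sameRowDifferences {A} {B} LA≈LB i j a q =
    x-y≈z-w⇒x-z≈y-w (Kernel.blocks-equal (λ p → A p q - B p q) L[A-B]≈0 i j a)
    where
    L[A-B]≈0 : ∀ p → (L *ⱽ (λ r → A r q - B r q)) p ≈ 0#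
    L[A-B]≈0 p = begin
      ∑[ r < n * k ] (L p r ⊛ (A r q - B r q))
        ≈⟨ sum-cong-≋ (λ r → x[y-z]≈xy-xz (L p r) (A r q) (B r q)) ⟩
      ∑[ r < n * k ] (L p r ⊛ A r q - L p r ⊛ B r q)
        ≈⟨ ∑-distrib-minus (λ r → L p r ⊛ A r q) (λ r → L p r ⊛ B r q) ⟩
      (L *ᴹ A) p q - (L *ᴹ B) p q
        ≈⟨ x≈y⇒x∙y⁻¹≈ε (LA≈LB p q) ⟩
      0# ∎

  -- The transposed version of the previous lemma: since `L` is symmetric, `L *ᴹ X ᵀ` is the
  -- transpose of `X *ᴹ L`.
  equalCoimages⇒sameColumnDifferences : ∀ {A B : Matrix (n * k) (n * k)} →
    A *ᴹ L ≈ᴹ B *ᴹ L → SameRowDifferences {n} {k} (A ᵀ) (B ᵀ)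
  equalCoimages⇒sameColumnDifferences {A} {B} AL≈BL =
    equalImages⇒sameRowDifferences
      (≈ᴹ-trans (L*Xᵀ A) (≈ᴹ-trans (λ p q → AL≈BL q p) (≈ᴹ-sym (L*Xᵀ B))))
    where
    L*Xᵀ : ∀ X → L *ᴹ X ᵀ ≈ᴹ (X *ᴹ L) ᵀ
    L*Xᵀ X p q = trans (*ᴹ-congʳ (X ᵀ) (≈ᴹ-sym laplacian-symmetric) p q) (sym (ᵀ-*ᴹ X L p q))

  -- Resistances and the Kirchhoff index through the Moore-Penrose inverse.

  module _ {L⁺ : Matrix (n * k) (n * k)} (mp : IsMoorePenroseInverse L L⁺) where

    open IsMoorePenroseInverse mp

    -- With D = L⁺ L C, the columns of C − D and the rows of D − L⁺ lie in the kernel of L, so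
    -- the differences have equal block rows, respectively equal block columns.
    resistance-independent : ∀ {C} → Is[1]-Inverse L C →
      ∀ i j → resistanceBlock {n} {k} C i j ≈ᴹ resistanceBlock {n} {k} L⁺ i j
    resistance-independent {C} LCL≈L i j a b = begin
      resistanceBlock {n} {k} C i j a b
        ≈⟨ resistanceBlock-row C D (equalImages⇒sameRowDifferences LC≈LD) i j a b ⟩
      resistanceBlock {n} {k} D i j a b
        ≈⟨ resistanceBlock-ᵀ D i j b a ⟨
      resistanceBlock {n} {k} (D ᵀ) i j b a
        ≈⟨ resistanceBlock-row (D ᵀ) (L⁺ ᵀ) (equalCoimages⇒sameColumnDifferences DL≈L⁺L) i j b a ⟩
      resistanceBlock {n} {k} (L⁺ ᵀ) i j b a
        ≈⟨ resistanceBlock-ᵀ L⁺ i j b a ⟩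
      resistanceBlock {n} {k} L⁺ i j a b ∎
      where
      D : Matrix (n * k) (n * k)
      D = L⁺ *ᴹ (L *ᴹ C)

      LC≈LD : L *ᴹ C ≈ᴹ L *ᴹ D
      LC≈LD p q = begin
        (L *ᴹ C) p q                   ≈⟨ *ᴹ-congʳ C MM⁺M≈M p q ⟨
        (L *ᴹ L⁺ *ᴹ L *ᴹ C) p q        ≈⟨ *ᴹ-assoc (L *ᴹ L⁺) L C p q ⟩
        (L *ᴹ L⁺ *ᴹ (L *ᴹ C)) p q      ≈⟨ *ᴹ-assoc L L⁺ (L *ᴹ C) p q ⟩
        (L *ᴹ D) p q                   ∎

      DL≈L⁺L : D *ᴹ L ≈ᴹ L⁺ *ᴹ L
      DL≈L⁺L p q = trans (*ᴹ-assoc L⁺ (L *ᴹ C) L p q) (*ᴹ-congˡ L⁺ LCL≈L p q)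

    -- Since `L⁺` factors as `L *ᴹ M`, its columns are combinations of columns of `L`, whose block
    -- sums vanish.
    pseudoinverse-columnSum : ∀ a q → ∑[ i < n ] L⁺ (combine i a) q ≈ 0#
    pseudoinverse-columnSum a q = begin
      ∑[ i < n ] L⁺ (combine i a) q
        ≈⟨ sum-cong-≋ {n} (λ i → L⁺≈LM (combine i a) q) ⟩
      ∑[ i < n ] ∑[ r < n * k ] (L (combine i a) r ⊛ M r q)
        ≈⟨ ∑-comm {n} (λ i r → L (combine i a) r ⊛ M r q) ⟩
      ∑[ r < n * k ] ∑[ i < n ] (L (combine i a) r ⊛ M r q)
        ≈⟨ ∑-zero {n * k} (λ r → trans (sym (*-distribʳ-sum {n} (M r q) (λ i → L (combine i a) r)))
             (trans (*-congʳ (laplacian-columnSum a r)) (zeroˡ (M r q)))) ⟩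
      0# ∎
      where
      M : Matrix (n * k) (n * k)
      M = L⁺ ᵀ *ᴹ L⁺

      L⁺≈LM : L⁺ ≈ᴹ L *ᴹ M
      L⁺≈LM p q = begin
        -- Replacing the symmetric `L⁺ *ᴹ L` by its transpose `L *ᴹ L⁺ ᵀ` brings `L` to the left end
        -- of the product.
        L⁺ p q                     ≈⟨ M⁺MM⁺≈M⁺ p q ⟨
        (L⁺ *ᴹ L *ᴹ L⁺) p q        ≈⟨ *ᴹ-congʳ L⁺ M⁺M-symmetric p q ⟨
        ((L⁺ *ᴹ L) ᵀ *ᴹ L⁺) p q    ≈⟨ *ᴹ-congʳ L⁺ (ᵀ-*ᴹ L⁺ L) p q ⟩
        (L ᵀ *ᴹ L⁺ ᵀ *ᴹ L⁺) p q    ≈⟨ *ᴹ-congʳ L⁺ (*ᴹ-congʳ (L⁺ ᵀ) laplacian-symmetric) p q ⟩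
        (L *ᴹ L⁺ ᵀ *ᴹ L⁺) p q      ≈⟨ *ᴹ-assoc L (L⁺ ᵀ) L⁺ p q ⟩
        (L *ᴹ M) p q               ∎

    pseudoinverse-blockSum : ∀ a b → ∑[ i < n ] ∑[ j < n ] block L⁺ i j a b ≈ 0#
    pseudoinverse-blockSum a b = trans (∑-comm {n} {n} (λ i j → block L⁺ i j a b))
      (∑-zero {n} (λ j → pseudoinverse-columnSum a (combine j b)))

    ∑-resistance : ∀ a b → let S = n · ∑[ i < n ] block L⁺ i i a b in
      ∑[ i < n ] ∑[ j < n ] resistanceBlock {n} {k} L⁺ i j a b ≈ S ⊕ S
    ∑-resistance a b = begin
      ∑[ i < n ] ∑[ j < n ] (P i i ⊕ P j j - P i j - P j i)
        ≈⟨ ∑∑-minus (λ i j → P i i ⊕ P j j - P i j) (λ i j → P j i) ⟩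
      ∑[ i < n ] ∑[ j < n ] (P i i ⊕ P j j - P i j) - ∑[ i < n ] ∑[ j < n ] P j i
        ≈⟨ +-cong (∑∑-minus (λ i j → P i i ⊕ P j j) P)
                  (-‿cong (trans (∑-comm (λ i j → P j i)) (pseudoinverse-blockSum a b))) ⟩
      ∑[ i < n ] ∑[ j < n ] (P i i ⊕ P j j) - ∑[ i < n ] ∑[ j < n ] P i j - 0#
        ≈⟨ trans (x-0≈x _) (trans (+-congˡ (-‿cong (pseudoinverse-blockSum a b))) (x-0≈x _)) ⟩
      ∑[ i < n ] ∑[ j < n ] (P i i ⊕ P j j)
        ≈⟨ sum-cong-≋ {n} (λ i → ∑-distrib-+ {n} (λ j → P i i) (λ j → P j j)) ⟩
      ∑[ i < n ] (∑[ j < n ] P i i ⊕ ∑[ j < n ] P j j)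
        ≈⟨ ∑-distrib-+ {n} (λ i → ∑[ j < n ] P i i) (λ i → ∑[ j < n ] P j j) ⟩
      ∑[ i < n ] ∑[ j < n ] P i i ⊕ ∑[ i < n ] ∑[ j < n ] P j j
        -- Once the first double sum is swapped, both are constant in the outer index, hence `n`
        -- copies of the trace of blocks.
        ≈⟨ +-cong (trans (∑-comm {n} {n} (λ i j → P i i)) (sum-replicate n)) (sum-replicate n) ⟩
      n · ∑[ i < n ] P i i ⊕ n · ∑[ i < n ] P i i ∎
      where
      P : Fin n → Fin n → Carrier
      P i j = block L⁺ i j a b

      ∑∑-minus : ∀ (f g : Fin n → Fin n → Carrier) →
        ∑[ i < n ] ∑[ j < n ] (f i j - g i j) ≈
        ∑[ i < n ] ∑[ j < n ] f i j - ∑[ i < n ] ∑[ j < n ] g i j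
      ∑∑-minus f g = trans (sum-cong-≋ (λ i → ∑-distrib-minus (f i) (g i)))
        (∑-distrib-minus (λ i → ∑[ j < n ] f i j) (λ i → ∑[ j < n ] g i j))

    kirchhoffIndex-pseudoinverse : ∀ {C} → Is[1]-Inverse L C →
      kirchhoffIndex {n} {k} C ≈ᴹ n ·ᴹ sumᴹ (λ (i : Fin n) → block {n} {k} L⁺ i i)
    kirchhoffIndex-pseudoinverse {C} LCL≈L a b = begin
      ½ ⊛ ∑[ i < n ] ∑[ j < n ] block (resistanceMatrix {n} {k} C) i j a b
        ≈⟨ *-congˡ (sum-cong-≋ {n} (λ i → sum-cong-≋ {n} (λ j →
             trans (reflexive (block-fromBlocks (resistanceBlock {n} {k} C) i j a b))
                   (resistance-independent LCL≈L i j a b)))) ⟩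
      ½ ⊛ ∑[ i < n ] ∑[ j < n ] resistanceBlock {n} {k} L⁺ i j a b
        ≈⟨ *-congˡ (∑-resistance a b) ⟩
      ½ ⊛ (n · ∑[ i < n ] block L⁺ i i a b ⊕ n · ∑[ i < n ] block L⁺ i i a b)
        ≈⟨ ½[x+x]≈x _ ⟩
      n · ∑[ i < n ] block L⁺ i i a b ∎

theorem3p4 : ∀ {c ℓ₁ ℓ₂} (ℝ : RealNumbers c ℓ₁ ℓ₂) →
    let open MatrixWeighted ℝ in
    ∀ (n k : ℕ) (G : MatrixWeightedGraph n k)
    (W⁻¹ : Fin n → Fin n → Matrix k k) → AreWeightInverses G W⁻¹ →
    ∀ (L⁽¹⁾ : Matrix (n * k) (n * k)) → Is[1]-Inverse (laplacian G W⁻¹) L⁽¹⁾ →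
    ∀ (L⁺ : Matrix (n * k) (n * k)) → IsMoorePenroseInverse (laplacian G W⁻¹) L⁺ →
    kirchhoffIndex {n} {k} L⁽¹⁾ ≈ᴹ n ·ᴹ sumᴹ (λ (i : Fin n) → block {n} {k} L⁺ i i)
theorem3p4 ℝ n k G W⁻¹ W⁻¹-inverse L⁽¹⁾ L⁽¹⁾-inverse L⁺ mp =
  Laplacian.kirchhoffIndex-pseudoinverse ℝ G W⁻¹ W⁻¹-inverse mp L⁽¹⁾-inverse
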